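{- Let $\mathcal{K}$ be a class of models of the same vocabulary. Then the following conditions are equivalent: (1) $\mathcal{K}$ is closed under isomorphisms. (2) $\mathcal{K}$ is cardinal dependently definable in $\Delta(L_{\infty\omega})$; that is, for every cardinal $\lambda$ the class $\mathcal{K}_\lambda$ of those members of $\mathcal{K}$ whose domain has cardinality $\lambda$ is $\Delta$-definable in $L_{\infty\omega}$.
   Context: A vocabulary is a set of non-logical symbols; models (structures) have set-sized domains and are single-sorted. Classes are definable classes of set theory (set parameters are allowed in the definition). $L_{\infty\omega}=\bigcup_\kappa L_{\kappa^+\omega}$ is the infinitary logic extending first order logic with conjunctions and disjunctions of arbitrary sets of formulas, but only finite strings of quantifiers. A class of models of a vocabulary $L$ is $L_{\infty\omega}$-definable if it is the class of all $L$-structures satisfying some single sentence of $L_{\infty\omega}$ in the vocabulary $L$. If $\mathcal{C}$ is a class of models of vocabulary $L$ and $L'\subseteq L$, then $\mathcal{C}\upharpoonright L'$ denotes the class of reducts $\mathcal{M}\upharpoonright L'$ of models $\mathcal{M}\in\mathcal{C}$, and $\mathcal{C}\upharpoonright L'$ is called a projection of $\mathcal{C}$. A class of models is $\Sigma(L^*)$-definable (for a logic $L^*$) if it is a projection of an $L^*$-definable class of models. A class $\mathcal{C}$ of models of a vocabulary is $\Delta$-definable in $L^*$ (equivalently, definable in $\Delta(L^*)$) if both $\mathcal{C}$ and its complement (in the class of all structures of that vocabulary) are $\Sigma(L^*)$-definable. The single-sorted version is used: projections only forget symbols and do not change the domain. -}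

module Defs where

open import Data.Fin.Base using (Fin)
open import Data.Nat.Base using (ℕ; zero; suc)
open import Data.Product.Base using (Σ-syntax; ∃-syntax; _×_)
open import Data.Sum.Base using (_⊎_; inj₁)
open import Data.Vec.Base as Vec using (Vec; []; _∷_)
open import Function.Base using (_∘_)
open import Function.Bundles using (_⤖_; _⇔_; module Bijection)
open import Level using (Level; _⊔_) renaming (suc to lsuc)
open import Relation.Binary.PropositionalEquality.Core using (_≡_)
open import Relation.Nullary.Negation.Core using (¬_)
open import Relation.Unary using (Pred; ∁; _∩_; _≐_)

-- Throughout, "set" means element of an arbitrary but fixed universe Set u,
-- and "class" means predicate, at an arbitrary level ℓ.

-- Symbols are sorted by arity; constants are the function symbols of arity 0.
record Vocabulary (u : Level) : Set (lsuc u) where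
  field
    Fun : ℕ → Set u
    Rel : ℕ → Set u

open Vocabulary public

-- Nonemptiness is doubly negated because a field of type Dom would be an extra
-- distinguished element.
record Structure {u : Level} (L : Vocabulary u) : Set (lsuc u) where
  field
    Dom      : Set u
    fun      : ∀ {k} → Fun L k → Vec Dom k → Dom
    rel      : ∀ {k} → Rel L k → Vec Dom k → Set u
    nonempty : ¬ ¬ Dom

open Structure public

Class : {u : Level} → Vocabulary u → (ℓ : Level) → Set (lsuc u ⊔ lsuc ℓ)
Class L ℓ = Pred (Structure L) ℓ

infix 4 _≅_

record _≅_ {u : Level} {L : Vocabulary u} (M N : Structure L) : Set u where
  field
    bijection : Dom M ⤖ Dom N
  open Bijection bijection public using (to)
  field
    fun-preserved : ∀ {k} (f : Fun L k) (xs : Vec (Dom M) k) →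
                    to (fun M f xs) ≡ fun N f (Vec.map to xs)
    rel-preserved : ∀ {k} (R : Rel L k) (xs : Vec (Dom M) k) →
                    rel M R xs ⇔ rel N R (Vec.map to xs)

ClosedUnderIsomorphism : {u ℓ : Level} {L : Vocabulary u} →
                         Class L ℓ → Set (lsuc u ⊔ ℓ)
ClosedUnderIsomorphism K = ∀ {M N} → M ≅ N → K M → K N

data Term {u : Level} (L : Vocabulary u) (n : ℕ) : Set u where
  var : Fin n → Term L n
  app : ∀ {k} → Fun L k → Vec (Term L n) k → Term L n

-- L_∞ω with de Bruijn variables: Formula L n has its free variables among n
-- variables. A quantifier binds one variable, and every subformula of a
-- sentence lies under finitely many quantifiers, so finite contexts lose no
-- sentences.
data Formula {u : Level} (L : Vocabulary u) (n : ℕ) : Set (lsuc u) where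
  _≈′_ : Term L n → Term L n → Formula L n
  rel′ : ∀ {k} → Rel L k → Vec (Term L n) k → Formula L n
  ¬′_  : Formula L n → Formula L n
  ⋀ ⋁  : (I : Set u) → (I → Formula L n) → Formula L n
  ∀′ ∃′ : Formula L (suc n) → Formula L n

Sentence : {u : Level} → Vocabulary u → Set (lsuc u)
Sentence L = Formula L zero

module _ {u : Level} {L : Vocabulary u} (M : Structure L) where

  eval  : ∀ {n} → Vec (Dom M) n → Term L n → Dom M
  evals : ∀ {n k} → Vec (Dom M) n → Vec (Term L n) k → Vec (Dom M) k

  eval ρ (var i)    = Vec.lookup ρ i
  eval ρ (app f ts) = fun M f (evals ρ ts)

  evals ρ []       = []
  evals ρ (t ∷ ts) = eval ρ t ∷ evals ρ ts

  Sat : ∀ {n} → Vec (Dom M) n → Formula L n → Set u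
  Sat ρ (s ≈′ t)    = eval ρ s ≡ eval ρ t
  Sat ρ (rel′ R ts) = rel M R (evals ρ ts)
  Sat ρ (¬′ φ)      = ¬ Sat ρ φ
  Sat ρ (⋀ I φ)     = ∀ (i : I) → Sat ρ (φ i)
  Sat ρ (⋁ I φ)     = Σ[ i ∈ I ] Sat ρ (φ i)
  Sat ρ (∀′ φ)      = ∀ (x : Dom M) → Sat (x ∷ ρ) φ
  Sat ρ (∃′ φ)      = Σ[ x ∈ Dom M ] Sat (x ∷ ρ) φ

infix 4 _⊨_

_⊨_ : {u : Level} {L : Vocabulary u} → Structure L → Sentence L → Set u
M ⊨ φ = Sat M [] φ

Mod : {u : Level} {L : Vocabulary u} → Sentence L → Class L u
Mod φ M = M ⊨ φ

-- A vocabulary extending L is given as L together with the set X of its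
-- additional symbols.
infixl 6 _∪ᵛ_

_∪ᵛ_ : {u : Level} → Vocabulary u → Vocabulary u → Vocabulary u
Fun (L ∪ᵛ X) k = Fun L k ⊎ Fun X k
Rel (L ∪ᵛ X) k = Rel L k ⊎ Rel X k

reduct : {u : Level} {L X : Vocabulary u} → Structure (L ∪ᵛ X) → Structure L
Dom      (reduct M) = Dom M
fun      (reduct M) = fun M ∘ inj₁
rel      (reduct M) = rel M ∘ inj₁
nonempty (reduct M) = nonempty M

Projection : {u ℓ : Level} {L X : Vocabulary u} →
             Class (L ∪ᵛ X) ℓ → Class L (lsuc u ⊔ ℓ)
Projection C M = ∃[ M⁺ ] C M⁺ × reduct M⁺ ≡ M

ΣDefinable : {u ℓ : Level} {L : Vocabulary u} → Class L ℓ → Set (lsuc u ⊔ ℓ)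
ΣDefinable {u} {L = L} C =
  Σ[ X ∈ Vocabulary u ] Σ[ φ ∈ Sentence (L ∪ᵛ X) ] C ≐ Projection (Mod φ)

ΔDefinable : {u ℓ : Level} {L : Vocabulary u} → Class L ℓ → Set (lsuc u ⊔ ℓ)
ΔDefinable C = ΣDefinable C × ΣDefinable (∁ C)

-- A cardinal is represented by any set Λ of that cardinality.
HasCardinality : {u : Level} {L : Vocabulary u} → Set u → Class L u
HasCardinality Λ M = Dom M ⤖ Λ

CardinalDependentlyΔDefinable : {u ℓ : Level} {L : Vocabulary u} →
                                Class L ℓ → Set (lsuc u ⊔ ℓ)
CardinalDependentlyΔDefinable {u} K =
  (Λ : Set u) → ΔDefinable (K ∩ HasCardinality Λ)

{-# OPTIONS --safe #-}

-- (2) ⇒ (1): projections of elementary classes are closed under isomorphisms,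
-- and N ≅ M puts N in the same cardinality class as M.
--
-- (1) ⇒ (2): K_Λ is defined by naming the elements of the domain by constants
-- c_l (l ∈ Λ) and taking the disjunction of all diagrams on Λ of members of K.
-- A structure M is outside K_Λ iff it satisfies a diagram on Λ outside K, or
-- is in bijection with a subset of Λ that is not in bijection with Λ, or does
-- not inject into Λ. For the last case take constants c_w indexed by the trees
-- with Λ-branching nodes and require c_(node g) ≠ c_(g l) for all g and l. If
-- M does not inject into Λ, such c_w are found by recursion on w, since no
-- Λ-indexed family exhausts M. If M injects into Λ, there are none: with i the
-- injection, choose g so that i c_(g l) = l whenever l has the form i c_w; then
-- l = i c_(node g) gives c_(g l) = c_(node g).

module Submission where

open import Defs
open import Axiom.ExcludedMiddle using (ExcludedMiddle)
open import Data.Bool.Base using (Bool; true; false; T)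
open import Data.Bool.Properties using (T-irrelevant)
open import Data.Empty.Polymorphic using (⊥)
open import Data.Fin.Base using (zero)
open import Data.Nat.Base using (ℕ; zero; suc)
open import Data.Product.Base using (Σ-syntax; ∃-syntax; _×_; _,_; proj₁; proj₂)
open import Data.Sum.Base using (inj₁; inj₂)
open import Data.Unit.Base using (tt)
open import Data.Vec.Base as Vec using (Vec; []; _∷_)
open import Data.Vec.Properties using (lookup-map; map-cong; map-id; map-∘)
open import Function.Base using (_∘_)
open import Function.Bundles
  using (_⤖_; _↣_; _⇔_; mk⤖; mk↣; mk⇔;
         module Bijection; module Equivalence; module Injection)
open import Function.Consequences.Propositional using (strictlySurjective⇒surjective)
open import Function.Definitions using (Bijective; StrictlySurjective)
open import Function.Properties.Bijection as Bij using (sym-≡)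
open import Level using (Level; _⊔_; Lift; lift; lower) renaming (suc to lsuc)
open import Relation.Binary.PropositionalEquality
  using (_≡_; _≢_; refl; sym; trans; cong; cong₂; subst; module ≡-Reasoning)
open import Relation.Nullary.Decidable
  using (Dec; yes; no; True; ⌊_⌋; toWitness; fromWitness; map′; decidable-stable)
open import Relation.Nullary.Negation using (¬_; contradiction)
open import Relation.Unary using (∁; _∩_)

private
  variable
    u ℓ : Level
    L X : Vocabulary u

lower-excludedMiddle : (a b : Level) → ExcludedMiddle (a ⊔ b) → ExcludedMiddle a
lower-excludedMiddle a b em = map′ lower (lift {ℓ = b}) em

-- Isomorphisms

≅-sym : {M N : Structure L} → M ≅ N → N ≅ M
≅-sym {M = M} {N} i = record
  { bijection     = sym-≡ bijection
  ; fun-preserved = λ f ys → injective (begin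
      to (to⁻ (fun N f ys))                 ≡⟨ to∘to⁻ _ ⟩
      fun N f ys                            ≡⟨ cong (fun N f) (sym (map-to∘to⁻ ys)) ⟩
      fun N f (Vec.map to (Vec.map to⁻ ys)) ≡⟨ sym (fun-preserved f (Vec.map to⁻ ys)) ⟩
      to (fun M f (Vec.map to⁻ ys))         ∎)
  ; rel-preserved = λ R ys → mk⇔
      (λ r → Equivalence.from (rel-preserved R _) (subst (rel N R) (sym (map-to∘to⁻ ys)) r))
      (λ r → subst (rel N R) (map-to∘to⁻ ys) (Equivalence.to (rel-preserved R _) r))
  }
  where
  open ≡-Reasoning
  open _≅_ i using (bijection; to; fun-preserved; rel-preserved)
  open Bijection bijection using (injective; to⁻; strictlySurjective)

  to∘to⁻ : ∀ y → to (to⁻ y) ≡ y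
  to∘to⁻ = proj₂ ∘ strictlySurjective

  map-to∘to⁻ : ∀ {k} (ys : Vec (Dom N) k) → Vec.map to (Vec.map to⁻ ys) ≡ ys
  map-to∘to⁻ ys = trans (sym (map-∘ to to⁻ ys)) (trans (map-cong to∘to⁻ ys) (map-id ys))

module _ {M N : Structure L} (i : M ≅ N) where
  open _≅_ i
  open Bijection bijection using (injective; strictlySurjective)

  eval-≅  : ∀ {n} (ρ : Vec (Dom M) n) (t : Term L n) →
            to (eval M ρ t) ≡ eval N (Vec.map to ρ) t
  evals-≅ : ∀ {n k} (ρ : Vec (Dom M) n) (ts : Vec (Term L n) k) →
            Vec.map to (evals M ρ ts) ≡ evals N (Vec.map to ρ) ts

  eval-≅ ρ (var j)    = sym (lookup-map j to ρ)
  eval-≅ ρ (app f ts) = trans (fun-preserved f _) (cong (fun N f) (evals-≅ ρ ts))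

  evals-≅ ρ []       = refl
  evals-≅ ρ (t ∷ ts) = cong₂ _∷_ (eval-≅ ρ t) (evals-≅ ρ ts)

  -- The induction carries both directions at once because negation exchanges them. Injectivity
  -- handles equality, surjectivity the quantifiers.
  Sat-≅ : ∀ {n} (ρ : Vec (Dom M) n) (φ : Formula L n) → Sat M ρ φ ⇔ Sat N (Vec.map to ρ) φ
  Sat-≅ ρ (s ≈′ t) = mk⇔
    (λ p → trans (sym (eval-≅ ρ s)) (trans (cong to p) (eval-≅ ρ t)))
    (λ p → injective (trans (eval-≅ ρ s) (trans p (sym (eval-≅ ρ t)))))
  Sat-≅ ρ (rel′ R ts) = mk⇔
    (λ p → subst (rel N R) (evals-≅ ρ ts) (Equivalence.to (rel-preserved R _) p))
    (λ p → Equivalence.from (rel-preserved R _) (subst (rel N R) (sym (evals-≅ ρ ts)) p))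
  Sat-≅ ρ (¬′ φ) = mk⇔
    (λ ¬p → ¬p ∘ Equivalence.from (Sat-≅ ρ φ))
    (λ ¬p → ¬p ∘ Equivalence.to (Sat-≅ ρ φ))
  Sat-≅ ρ (⋀ I φ) = mk⇔
    (λ p j → Equivalence.to (Sat-≅ ρ (φ j)) (p j))
    (λ p j → Equivalence.from (Sat-≅ ρ (φ j)) (p j))
  Sat-≅ ρ (⋁ I φ) = mk⇔
    (λ (j , p) → j , Equivalence.to (Sat-≅ ρ (φ j)) p)
    (λ (j , p) → j , Equivalence.from (Sat-≅ ρ (φ j)) p)
  Sat-≅ ρ (∀′ φ) = mk⇔
    (λ p y → let (x , x↦y) = strictlySurjective y in
       subst (λ z → Sat N (z ∷ Vec.map to ρ) φ) x↦y (Equivalence.to (Sat-≅ (x ∷ ρ) φ) (p x)))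
    (λ p x → Equivalence.from (Sat-≅ (x ∷ ρ) φ) (p (to x)))
  Sat-≅ ρ (∃′ φ) = mk⇔
    (λ (x , p) → to x , Equivalence.to (Sat-≅ (x ∷ ρ) φ) p)
    (λ (y , p) → let (x , x↦y) = strictlySurjective y in
       x , Equivalence.from (Sat-≅ (x ∷ ρ) φ)
             (subst (λ z → Sat N (z ∷ Vec.map to ρ) φ) (sym x↦y) p))

-- Expansions carried along isomorphisms of reducts

module _ (M⁺ : Structure (L ∪ᵛ X)) (N : Structure L) (i : reduct M⁺ ≅ N) where
  open _≅_ i
  private module I⁻ = _≅_ (≅-sym i)

  private
    map-to⁻∘to : ∀ {k} (xs : Vec (Dom M⁺) k) → Vec.map I⁻.to (Vec.map to xs) ≡ xs
    map-to⁻∘to xs = trans (sym (map-∘ I⁻.to to xs)) (trans (map-cong to⁻∘to xs) (map-id xs))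
      where
      open Bijection bijection using (injective; strictlySurjective)
      to⁻∘to : ∀ x → I⁻.to (to x) ≡ x
      to⁻∘to x = injective (proj₂ (strictlySurjective (to x)))

  -- The symbols of `L` are interpreted by `N` itself, so that the equality of structures in
  -- `Projection` is `refl`; only the additional symbols are carried over from `M⁺`.
  transport : Structure (L ∪ᵛ X)
  Dom      transport             = Dom N
  fun      transport (inj₁ f)    = fun N f
  fun      transport (inj₂ f) ys = to (fun M⁺ (inj₂ f) (Vec.map I⁻.to ys))
  rel      transport (inj₁ R)    = rel N R
  rel      transport (inj₂ R) ys = rel M⁺ (inj₂ R) (Vec.map I⁻.to ys)
  nonempty transport             = nonempty N

  transport-≅ : M⁺ ≅ transport
  transport-≅ = record
    { bijection     = bijection
    ; fun-preserved = λ
      { (inj₁ f) xs → fun-preserved f xs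
      ; (inj₂ f) xs → cong (to ∘ fun M⁺ (inj₂ f)) (sym (map-to⁻∘to xs))
      }
    ; rel-preserved = λ
      { (inj₁ R) xs → rel-preserved R xs
      ; (inj₂ R) xs → mk⇔ (subst (rel M⁺ (inj₂ R)) (sym (map-to⁻∘to xs)))
                           (subst (rel M⁺ (inj₂ R)) (map-to⁻∘to xs))
      }
    }

ΣDefinable⇒closed : {C : Class L ℓ} → ΣDefinable C → ClosedUnderIsomorphism C
ΣDefinable⇒closed {L = L} (X , φ , C⊆P , P⊆C) {M} {N} i M∈C = P⊆C (transfer (C⊆P M∈C) i)
  where
  transfer : Projection (Mod φ) M → M ≅ N → Projection (Mod φ) N
  transfer (M⁺ , M⁺⊨φ , refl) i =
    transport M⁺ N i , Equivalence.to (Sat-≅ (transport-≅ M⁺ N i) [] φ) M⁺⊨φ , refl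

-- Propositional connectives

infixr 6 _∧′_
infixr 5 _∨′_

_∧′_ _∨′_ : ∀ {n} → Formula L n → Formula L n → Formula L n
φ ∧′ ψ = ⋀ (Lift _ Bool) λ { (lift true) → φ ; (lift false) → ψ }
φ ∨′ ψ = ⋁ (Lift _ Bool) λ { (lift true) → φ ; (lift false) → ψ }

signed : ∀ {n} → Bool → Formula L n → Formula L n
signed true  φ = φ
signed false φ = ¬′ φ

module _ {M : Structure L} {n : ℕ} {ρ : Vec (Dom M) n} where

  ∧-intro : {φ ψ : Formula L n} → Sat M ρ φ → Sat M ρ ψ → Sat M ρ (φ ∧′ ψ)
  ∧-intro p q (lift true)  = p
  ∧-intro p q (lift false) = q

  signed⇔ : ∀ b {φ} → Sat M ρ (signed b φ) ⇔ (T b ⇔ Sat M ρ φ)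
  signed⇔ true  = mk⇔ (λ p → mk⇔ (λ _ → p) (λ _ → tt)) (λ e → Equivalence.to e tt)
  signed⇔ false = mk⇔ (λ ¬p → mk⇔ (λ ()) ¬p) (λ e → Equivalence.from e)

-- Expansions by constants

Constants : Set u → Vocabulary u
Fun (Constants C) zero    = C
Fun (Constants C) (suc k) = ⊥
Rel (Constants C) k       = ⊥

expand : {C : Set u} (M : Structure L) → (C → Dom M) → Structure (L ∪ᵛ Constants C)
Dom      (expand M v)                     = Dom M
fun      (expand M v) (inj₁ f)            = fun M f
fun      (expand M v) {zero}  (inj₂ c)  _ = v c
fun      (expand M v) {suc _} (inj₂ ())
rel      (expand M v) (inj₁ R)            = rel M R
rel      (expand M v) (inj₂ ())
nonempty (expand M v)                     = nonempty M

module _ {L : Vocabulary u} {C : Set u} where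

  name : C → ∀ {n} → Term (L ∪ᵛ Constants C) n
  name c = app {k = zero} (inj₂ c) []

  named : (M : Structure (L ∪ᵛ Constants C)) → C → Dom M
  named M c = fun M {zero} (inj₂ c) []

  evals-names : ∀ {A : Set u} (h : A → C) (M : Structure (L ∪ᵛ Constants C)) {k}
                (as : Vec A k) →
                evals M [] (Vec.map (λ a → name (h a)) as) ≡ Vec.map (named M ∘ h) as
  evals-names h M []       = refl
  evals-names h M (a ∷ as) = cong (_ ∷_) (evals-names h M as)

  module _ {A : Set u} (h : A → C) where

    -- Names pass through `h` so that the same sentences serve constants indexed by Λ, with `h` the
    -- identity, and constants indexed by trees, with `h` placing Λ or a subset of it among the
    -- leaves.
    namesDistinct namesExhaust namesBijectively : Sentence (L ∪ᵛ Constants C)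
    namesDistinct = ⋀ (Σ[ (a , b) ∈ A × A ] a ≢ b) λ ((a , b) , _) →
      ¬′ (name (h a) ≈′ name (h b))
    namesExhaust = ∀′ (⋁ A λ a → name (h a) ≈′ var zero)
    namesBijectively = namesDistinct ∧′ namesExhaust

    ⊨namesBijectively : ExcludedMiddle u → (M : Structure (L ∪ᵛ Constants C)) →
      M ⊨ namesBijectively ⇔ Bijective _≡_ _≡_ (named M ∘ h)
    ⊨namesBijectively em M = mk⇔
      -- The sentence separates distinct indices; excluded middle turns this contrapositive into
      -- injectivity.
      (λ p → (λ {a} {b} ha≡hb → decidable-stable em λ a≢b →
                p (lift true) ((a , b) , a≢b) ha≡hb)
           , strictlySurjective⇒surjective (p (lift false)))
      (λ (inj , surj) → ∧-intro {φ = namesDistinct} {namesExhaust}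
        (λ ((a , b) , a≢b) → a≢b ∘ inj)
        (λ x → proj₁ (surj x) , proj₂ (surj x) refl))

-- Diagrams

-- Boolean relations keep the diagrams on Λ in `Set u`, so a disjunction can range over all of them,
-- whereas `Structure L` lives one universe higher.
record Diagram (L : Vocabulary u) (Λ : Set u) : Set u where
  field
    operation : ∀ {k} → Fun L k → Vec Λ k → Λ
    holds     : ∀ {k} → Rel L k → Vec Λ k → Bool
    inhabited : ¬ ¬ Λ

open Diagram

module _ {L : Vocabulary u} {Λ : Set u} where

  structure : Diagram L Λ → Structure L
  Dom      (structure D)     = Λ
  fun      (structure D)     = operation D
  rel      (structure D) R v = Lift _ (T (holds D R v))
  nonempty (structure D)     = inhabited D

  module _ (em : ExcludedMiddle u) where

    diagramOf : (M : Structure L) → Dom M ⤖ Λ → Diagram L Λ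
    diagramOf M b = record
      { operation = λ f v → to (fun M f (Vec.map to⁻ v))
      ; holds     = λ R v → ⌊ em {rel M R (Vec.map to⁻ v)} ⌋
      ; inhabited = λ ¬Λ → nonempty M (¬Λ ∘ to)
      }
      where open Bijection b using (to; to⁻)

    -- Diagrams thus capture every structure of cardinality Λ up to isomorphism. The underlying map
    -- is `to⁻ b`, which later interprets the constants `h l`.
    structure-diagramOf : (M : Structure L) (b : Dom M ⤖ Λ) → structure (diagramOf M b) ≅ M
    structure-diagramOf M b = record
      { bijection     = sym-≡ b
      ; fun-preserved = λ f v → injective (proj₂ (strictlySurjective _))
      ; rel-preserved = λ R v → mk⇔ (λ t → toWitness (lower t)) (λ r → lift (fromWitness r))
      }
      where open Bijection b using (injective; strictlySurjective)

  module _ {C : Set u} (h : Λ → C) (D : Diagram L Λ) where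

    private
      names : ∀ {k} → Vec Λ k → Vec (Term (L ∪ᵛ Constants C) zero) k
      names = Vec.map (λ l → name (h l))

    -- `isCopyOf` is the positive and negative atomic diagram of `structure D`, together with the
    -- clause that the names list the domain without repetition.
    functionsOf relationsOf isCopyOf : Sentence (L ∪ᵛ Constants C)
    functionsOf = ⋀ (∃[ k ] Fun L k × Vec Λ k) λ (_ , f , v) →
      app (inj₁ f) (names v) ≈′ name (h (operation D f v))
    relationsOf = ⋀ (∃[ k ] Rel L k × Vec Λ k) λ (_ , R , v) →
      signed (holds D R v) (rel′ (inj₁ R) (names v))
    isCopyOf = namesBijectively h ∧′ functionsOf ∧′ relationsOf

    module _ (em : ExcludedMiddle u) (M : Structure (L ∪ᵛ Constants C)) where

      private
        ev : ∀ {k} (v : Vec Λ k) → evals M [] (names v) ≡ Vec.map (named M ∘ h) v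
        ev = evals-names h M

      isCopyOf⇒≅ : M ⊨ isCopyOf → structure D ≅ reduct M
      isCopyOf⇒≅ p = record
        { bijection     = mk⤖ (Equivalence.to (⊨namesBijectively h em M) (p (lift true)))
        ; fun-preserved = λ f v →
            trans (sym (p (lift false) (lift true) (_ , f , v))) (cong (fun M (inj₁ f)) (ev v))
        ; rel-preserved = λ R v →
            let e = Equivalence.to (signed⇔ (holds D R v) {rel′ (inj₁ R) (names v)})
                      (p (lift false) (lift false) (_ , R , v))
            in mk⇔ (λ t → subst (rel M (inj₁ R)) (ev v) (Equivalence.to e (lower t)))
                   (λ r → lift (Equivalence.from e (subst (rel M (inj₁ R)) (sym (ev v)) r)))
        }

      ≅⇒isCopyOf : (i : structure D ≅ reduct M) → (∀ l → _≅_.to i l ≡ named M (h l)) →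
                   M ⊨ isCopyOf
      ≅⇒isCopyOf i to≗named = ∧-intro {φ = namesBijectively h} {functionsOf ∧′ relationsOf}
        (Equivalence.from (⊨namesBijectively h em M) bijective-named)
        (∧-intro {φ = functionsOf} {relationsOf}
          (λ (_ , f , v) → trans (cong (fun M (inj₁ f)) (evals≡map-to v))
                             (trans (sym (fun-preserved f v)) (to≗named _)))
          (λ (_ , R , v) → Equivalence.from (signed⇔ (holds D R v) {rel′ (inj₁ R) (names v)})
            (mk⇔ (λ t → subst (rel M (inj₁ R)) (sym (evals≡map-to v))
                          (Equivalence.to (rel-preserved R v) (lift t)))
                 (λ r → lower (Equivalence.from (rel-preserved R v)
                          (subst (rel M (inj₁ R)) (evals≡map-to v) r))))))
        where
        open _≅_ i
        open Bijection bijection using (injective; strictlySurjective)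

        evals≡map-to : ∀ {k} (v : Vec Λ k) → evals M [] (names v) ≡ Vec.map to v
        evals≡map-to v = trans (ev v) (map-cong (sym ∘ to≗named) v)

        bijective-named : Bijective _≡_ _≡_ (named M ∘ h)
        bijective-named =
          (λ p → injective (trans (to≗named _) (trans p (sym (to≗named _))))) ,
          strictlySurjective⇒surjective λ x →
            let (l , l↦x) = strictlySurjective x in l , trans (sym (to≗named l)) l↦x

module _ {L : Vocabulary u} {Λ C : Set u} (em : ExcludedMiddle u) (emK : ExcludedMiddle ℓ)
         (K : Class L ℓ) (h : Λ → C) where

  -- `K` may live at any level, but a disjunction needs an index in `Set u`; `True` of the decision
  -- replaces membership by a small type.
  isCopyOfMember : Sentence (L ∪ᵛ Constants C)
  isCopyOfMember = ⋁ (Σ[ D ∈ Diagram L Λ ] True (emK {K (structure D)})) λ (D , _) →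
    isCopyOf h D

  module _ (closed : ClosedUnderIsomorphism K) where

    isCopyOfMember⇒∈ : (M : Structure (L ∪ᵛ Constants C)) → M ⊨ isCopyOfMember →
                       (K ∩ HasCardinality Λ) (reduct M)
    isCopyOfMember⇒∈ M ((D , D∈K) , p) = closed i (toWitness D∈K) , sym-≡ (_≅_.bijection i)
      where i = isCopyOf⇒≅ h D em M p

    -- The diagram of `M` along `b` is one of the disjuncts, since closure under isomorphisms puts
    -- its structure in `K`.
    ∈⇒isCopyOfMember : (M : Structure L) → K M → (b : Dom M ⤖ Λ) (v : C → Dom M) →
                       (∀ l → Bijection.to⁻ b l ≡ v (h l)) → expand M v ⊨ isCopyOfMember
    ∈⇒isCopyOfMember M M∈K b v to⁻≗v =
      (D , fromWitness (closed (≅-sym i) M∈K)) , ≅⇒isCopyOf h D em (expand M v) i to⁻≗v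
      where
      D = diagramOf em M b
      i = structure-diagramOf em M b

-- Cardinalities other than that of Λ

data Tree (Λ : Set u) : Set u where
  leaf : Λ → Tree Λ
  node : (Λ → Tree Λ) → Tree Λ

label : {A Λ : Set u} → A → (Λ → A) → Tree Λ → A
label x v (leaf l) = v l
label x v (node g) = x

module _ {Λ : Set u} (em : ExcludedMiddle u) where

  noEvasion : {A : Set u} → A ↣ Λ → (c : Tree Λ → A) →
              ¬ (∀ g l → c (node g) ≢ c (g l))
  -- The code in Λ of the value at `node preimage` is attained, with `node preimage` itself as
  -- witness, so `preimage` sends this code to a tree with the same value.
  noEvasion i c evades = evades preimage (to (c (node preimage)))
    (sym (injective (to-preimage (node preimage) refl)))
    where
    open Injection i using (to; injective)

    find : ∀ l → Dec (∃[ w ] to (c w) ≡ l) → Tree Λ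
    find l (yes (w , _)) = w
    -- Any tree would do for a code that is not attained.
    find l (no _)        = leaf l

    preimage : Λ → Tree Λ
    preimage l = find l em

    to-find : ∀ w {l} → to (c w) ≡ l → (d : Dec (∃[ w ] to (c w) ≡ l)) → to (c (find l d)) ≡ l
    to-find w p (yes (_ , q)) = q
    to-find w p (no ¬q)       = contradiction (w , p) ¬q

    to-preimage : ∀ w {l} → to (c w) ≡ l → to (c (preimage l)) ≡ l
    to-preimage w p = to-find w p em

  -- A section of a surjection is injective. In `fresh` this shows that a set without an injection
  -- into Λ is not exhausted by any Λ-indexed family.
  surjection⇒↣ : {A : Set u} (f : Λ → A) → StrictlySurjective _≡_ f → A ↣ Λ
  surjection⇒↣ f surj = mk↣ {to = proj₁ ∘ surj}
    (λ {x} {y} p → trans (sym (proj₂ (surj x))) (trans (cong f p) (proj₂ (surj y))))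

  module _ {A : Set u} (¬A↣Λ : ¬ (A ↣ Λ)) where

    fresh : (f : Λ → A) → ∃[ x ] (∀ l → x ≢ f l)
    fresh f = decidable-stable em λ none → ¬A↣Λ (surjection⇒↣ f λ x →
      decidable-stable em λ x∉f → none (x , λ l x≡fl → x∉f (l , sym x≡fl)))

    -- At a node the values at the children are already chosen and form a Λ-indexed family, which
    -- misses some element.
    evading : A → Tree Λ → A
    evading x (leaf l) = x
    evading x (node g) = proj₁ (fresh (λ l → evading x (g l)))

    evading-evades : (x : A) → ∀ g l → evading x (node g) ≢ evading x (g l)
    evading-evades x g = proj₂ (fresh (λ l → evading x (g l)))

  module _ {A : Set u} (i : A ↣ Λ) where
    open Injection i using (to; injective)

    inImage : Λ → Bool
    inImage l = ⌊ em {∃[ x ] to x ≡ l} ⌋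

    private
      find : ∀ {l} → A → Dec (∃[ x ] to x ≡ l) → A
      find x₀ (yes (x , _)) = x
      find x₀ (no _)        = x₀

      to-find : ∀ {l} x₀ (d : Dec (∃[ x ] to x ≡ l)) → T ⌊ d ⌋ → to (find x₀ d) ≡ l
      to-find x₀ (yes (_ , p)) _ = p

    -- A left inverse of `i`, extended by the default `x₀` off the image because every leaf constant
    -- needs a value.
    retraction : A → Λ → A
    retraction x₀ l = find x₀ (em {∃[ x ] to x ≡ l})

    retraction-bijective : (x₀ : A) →
      Bijective _≡_ _≡_ (λ ((l , _) : Σ[ l ∈ Λ ] T (inImage l)) → retraction x₀ l)
    retraction-bijective x₀ =
      (λ { {l , s} {l′ , s′} p → Σ-≡ (trans (sym (to-find x₀ em s))
                                        (trans (cong to p) (to-find x₀ em s′))) }) ,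
      strictlySurjective⇒surjective λ x →
        let s = fromWitness (x , refl) in (to x , s) , injective (to-find x₀ em s)
      where
      Σ-≡ : ∀ {l l′} {s : T (inImage l)} {s′ : T (inImage l′)} → l ≡ l′ →
            _≡_ {A = Σ[ l ∈ Λ ] T (inImage l)} (l , s) (l′ , s′)
      Σ-≡ refl = cong (_ ,_) (T-irrelevant _ _)

module _ (L : Vocabulary u) (Λ : Set u) where

  -- Subsets of Λ are Boolean-valued so that they can index a disjunction in `Set u`.
  hasOtherSubcardinality doesNotInject : Sentence (L ∪ᵛ Constants (Tree Λ))
  hasOtherSubcardinality =
    ⋁ (Σ[ s ∈ (Λ → Bool) ] ¬ ((Σ[ l ∈ Λ ] T (s l)) ⤖ Λ)) λ (s , _) →
      namesBijectively {A = Σ[ l ∈ Λ ] T (s l)} (λ (l , _) → leaf l)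
  doesNotInject = ⋀ ((Λ → Tree Λ) × Λ) λ (g , l) → ¬′ (name (node g) ≈′ name (g l))

-- The members of cardinality Λ and the complementary class as projections

module _ {L : Vocabulary u} (em : ExcludedMiddle u) (emK : ExcludedMiddle ℓ)
         (K : Class L ℓ) (closed : ClosedUnderIsomorphism K) (Λ : Set u) where

  element : (M : Structure L) → Dom M
  element M = decidable-stable em (nonempty M)

  ∩-ΣDefinable : ΣDefinable (K ∩ HasCardinality Λ)
  ∩-ΣDefinable = Constants Λ , isCopyOfMember em emK K (λ l → l) ,
    (λ {M} (M∈K , b) → expand M (Bijection.to⁻ b) ,
      ∈⇒isCopyOfMember em emK K (λ l → l) closed M M∈K b _ (λ _ → refl) , refl) ,
    λ { (M , p , refl) → isCopyOfMember⇒∈ em emK K (λ l → l) closed M p }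

  ∁-∩-ΣDefinable : ΣDefinable (∁ (K ∩ HasCardinality Λ))
  ∁-∩-ΣDefinable = Constants (Tree Λ) , φ , forth , λ { (M , p , refl) → back M p }
    where
    ∁K-closed : ClosedUnderIsomorphism (∁ K)
    ∁K-closed i M∉K N∈K = M∉K (closed (≅-sym i) N∈K)

    φ : Sentence (L ∪ᵛ Constants (Tree Λ))
    φ = isCopyOfMember em emK (∁ K) leaf ∨′ hasOtherSubcardinality L Λ ∨′ doesNotInject L Λ

    forth : ∀ {M} → ∁ (K ∩ HasCardinality Λ) M → Projection (Mod φ) M
    forth {M} M∉ with em {Dom M ⤖ Λ} | em {Dom M ↣ Λ}
    -- Here the domain has cardinality Λ, so `M` lies outside `K` and its own diagram is a disjunct
    -- for the complement. The node constants get a default value.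
    ... | yes b | _ =
      expand M (label (element M) (Bijection.to⁻ b)) ,
      (lift true , ∈⇒isCopyOfMember em emK (∁ K) leaf ∁K-closed M (λ M∈K → M∉ (M∈K , b)) b _
                     (λ _ → refl)) ,
      refl
    -- The image of the domain in Λ is equinumerous with the domain, hence not with Λ.
    ... | no ¬b | yes i =
      M⁺ ,
      (lift false , lift true , (inImage em i , λ b → ¬b (Bij.trans (sym-≡ enumeration) b)) ,
        Equivalence.from (⊨namesBijectively _ em M⁺) (Bijection.bijective enumeration)) ,
      refl
      where
      M⁺ = expand M (label (element M) (retraction em i (element M)))
      enumeration = mk⤖ (retraction-bijective em i (element M))
    ... | no _  | no ¬i =
      expand M (evading em ¬i (element M)) ,
      (lift false , lift false , λ (g , l) → evading-evades em ¬i (element M) g l) ,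
      refl

    back : ∀ M → M ⊨ φ → ∁ (K ∩ HasCardinality Λ) (reduct M)
    back M (lift true , p) (M∈K , _) =
      proj₁ (isCopyOfMember⇒∈ em emK (∁ K) leaf ∁K-closed M p) M∈K
    back M (lift false , lift true , (s , ¬b) , p) (_ , b) =
      ¬b (Bij.trans (mk⤖ (Equivalence.to (⊨namesBijectively _ em M) p)) b)
    back M (lift false , lift false , p) (_ , b) =
      noEvasion em (Bijection.injection b) (named M) (λ g l → p (g , l))

theorem18 : {u ℓ : Level} → ExcludedMiddle (lsuc u ⊔ ℓ) →
    (L : Vocabulary u) (K : Class L ℓ) →
    ClosedUnderIsomorphism K ⇔ CardinalDependentlyΔDefinable K
theorem18 {u} {ℓ} em L K = mk⇔
  (λ (closed : ClosedUnderIsomorphism K) Λ →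
    ∩-ΣDefinable em-u em-ℓ K closed Λ ,
    ∁-∩-ΣDefinable em-u em-ℓ K closed Λ)
  (λ definable {M} {N} i M∈K →
    -- With the domain of `N` as Λ, the isomorphism itself shows that `M` has cardinality Λ.
    proj₁ (ΣDefinable⇒closed (proj₁ (definable (Dom N))) i (M∈K , _≅_.bijection i)))
  where
  em-u : ExcludedMiddle u
  em-u = lower-excludedMiddle u (lsuc u ⊔ ℓ) em

  em-ℓ : ExcludedMiddle ℓ
  em-ℓ = lower-excludedMiddle ℓ (lsuc u ⊔ ℓ) em
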